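{- Let $\delta\geq 1$, $k\geq 0$, $h=k+1$, $t\geq 1$, $n\geq 2$ and $m$ be integers with $2m\ge n\delta$, and let $s$ be an integer with $$\frac{n}{t+1}\leq s\leq\frac{n}{t}\qquad\text{and}\qquad 2m=n(\delta+th)-\frac{s\,h\,t(t+1)}{2}.$$ Let $P$ be the sequence consisting of $s$ copies of each of $\delta,\delta+h,\ldots,\delta+(t-1)h$ and $n-ts$ copies of $\delta+th$. Let $b=n-ts$, and suppose that $s\geq\delta+(t-1)h+1$, that $s(\delta+ih)$ is even for $0\leq i<t$, and that either $b=0$ or $b\geq\delta+th+1$ with $b(\delta+th)$ even. Let $G_0$ be the disjoint union of a $(\delta+ih)$-regular circulant graph on $s$ vertices for each $0\leq i<t$ and, if $b>0$, of a $(\delta+th)$-regular circulant graph on $b$ vertices. Then $G_0$ has degree sequence $P$ and $\mathrm{sp}(G_0,k)=s=f_t(n,m,\delta,k)$; and for $\delta\geq 2$ there is also a connected graph with the same degree sequence $P$.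
   Context: Graphs are finite and simple. For a graph $G$ and $B\subseteq V(G)$ the spread is $\mathrm{sp}(B)=\max_{u\in B}\deg_G(u)-\min_{v\in B}\deg_G(v)$, and $\mathrm{sp}(G,k)$ is the largest cardinality of a set $B\subseteq V(G)$ with $\mathrm{sp}(B)\leq k$. Further, $$f_t(n,m,\delta,k)=\frac{2\left(n(\delta+t(k+1))-2m\right)}{(k+1)\,t(t+1)}.$$ The $q$-regular circulant graph on $r$ vertices, for $r\geq q+1$ and $qr$ even, may be taken to be the graph on $\mathbb{Z}/r\mathbb{Z}$ in which $i$ is joined to $i\pm1,\ldots,i\pm\lfloor q/2\rfloor$, and also to $i+r/2$ when $q$ is odd. -}

module Defs where

open import Data.Bool.Base using (if_then_else_)
open import Data.Empty using (⊥)
open import Data.Fin.Base using (Fin; toℕ; splitAt)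
import Data.Fin.Properties as Fin
open import Data.Fin.Subset using (Subset; ∣_∣)
open import Data.Fin.Subset.Properties using (_∈?_)
open import Data.Integer.Base as ℤ using (+_)
open import Data.List.Base
  using (List; []; _∷_; [_]; _++_; map; length; filter; foldr; concat; replicate; upTo; applyUpTo; allFin)
open import Data.List.Extrema.Nat using (max; min)
open import Data.List.Relation.Binary.Permutation.Propositional using (_↭_)
open import Data.List.Relation.Unary.Any as Any using (Any)
open import Data.Nat.Base
open import Data.Nat.Divisibility using (_∣_; _∣?_)
open import Data.Nat.Properties using (m*n≢0)
open import Data.Product.Base using (_×_; _,_; ∃)
open import Data.Rational.Base as ℚ using (ℚ)
open import Data.Sum.Base using (_⊎_; inj₁; inj₂)
import Data.Sum.Base as Sum
open import Data.Sum.Relation.Binary.Pointwise using (Pointwise; inj₁; inj₂; ⊎-symmetric; ⊎-decidable)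
open import Level using (0ℓ)
open import Relation.Binary.Construct.Closure.ReflexiveTransitive using (Star)
open import Relation.Binary.Core using (Rel)
open import Relation.Binary.Definitions using (Symmetric; Decidable)
open import Relation.Binary.PropositionalEquality using (_≡_; _≢_; refl; ≢-sym)
open import Relation.Nullary.Decidable using (does; ¬?; _×-dec_; _⊎-dec_)
open import Relation.Nullary.Negation using (¬_)

-- Finite simple graphs.

record Graph : Set₁ where
  field
    order    : ℕ
    Adj      : Rel (Fin order) 0ℓ
    adj?     : Decidable Adj
    adj-sym  : Symmetric Adj
    loopless : ∀ {v} → ¬ Adj v v

  Vertex : Set
  Vertex = Fin order

  degree : Vertex → ℕ
  degree v = length (filter (adj? v) (allFin order))

  degreesOn : Subset order → List ℕ
  degreesOn B = map degree (filter (_∈? B) (allFin order))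

open Graph public

Connected : Graph → Set
Connected G = ∀ (u v : Vertex G) → Star (Adj G) u v

-- Degree sequences are compared up to reordering.
HasDegreeSequence : Graph → List ℕ → Set
HasDegreeSequence G ds = map (degree G) (allFin (order G)) ↭ ds

-- The value at [] is a convention; max ≥ min on every nonempty list, so _∸_ is
-- then genuine subtraction.
range : List ℕ → ℕ
range []       = 0
range (d ∷ ds) = max d ds ∸ min d ds

spread : (G : Graph) → Subset (order G) → ℕ
spread G B = range (degreesOn G B)

-- Sp[ G , k ]≡ c  says that the largest cardinality of a vertex set of spread
-- at most k is c.
Sp[_,_]≡_ : Graph → ℕ → ℕ → Set
Sp[ G , k ]≡ c =
  (∃ λ (B : Subset (order G)) → spread G B ≤ k × ∣ B ∣ ≡ c) ×
  (∀ (B : Subset (order G)) → spread G B ≤ k → ∣ B ∣ ≤ c)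

f : (t n m δ k : ℕ) → .{{NonZero t}} → ℚ
f t n m δ k =
  (+ 2 ℤ.* (+ (n * (δ + t * suc k)) ℤ.- + (2 * m))) ℚ./ (suc k * (t * suc t))
  where instance
    _ : NonZero (t * suc t)
    _ = m*n≢0 t (suc t)
    _ : NonZero (suc k * (t * suc t))
    _ = m*n≢0 (suc k) (t * suc t)

∅ᴳ : Graph
∅ᴳ = record
  { order    = 0
  ; Adj      = λ _ _ → ⊥
  ; adj?     = λ ()
  ; adj-sym  = λ ()
  ; loopless = λ ()
  }

infixr 5 _⊎ᴳ_

_⊎ᴳ_ : Graph → Graph → Graph
G ⊎ᴳ H = record
  { order    = order G + order H
  ; Adj      = λ u v → Adj⊎ (splitAt (order G) u) (splitAt (order G) v)
  ; adj?     = λ u v → ⊎-decidable (adj? G) (adj? H) (splitAt (order G) u) (splitAt (order G) v)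
  ; adj-sym  = ⊎-symmetric (adj-sym G) (adj-sym H)
  ; loopless = λ {v} → loopless⊎ (splitAt (order G) v)
  }
  where
  Adj⊎ : Rel (Vertex G ⊎ Vertex H) 0ℓ
  Adj⊎ = Pointwise (Adj G) (Adj H)

  loopless⊎ : ∀ x → ¬ Adj⊎ x x
  loopless⊎ (inj₁ u) (inj₁ p) = loopless G p
  loopless⊎ (inj₂ v) (inj₂ p) = loopless H p

⨄ : List Graph → Graph
⨄ = foldr _⊎ᴳ_ ∅ᴳ

infix 4 _≡_[mod_]

_≡_[mod_] : ℕ → ℕ → ℕ → Set
a ≡ b [mod r ] = r ∣ ∣ a - b ∣

offsets : (q r : ℕ) → List ℕ
offsets q r = map suc (upTo ⌊ q /2⌋) ++ (if does (2 ∣? q) then [] else [ ⌊ r /2⌋ ])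

-- Vertices of Z/r are represented by 0, …, r−1, and i is joined to i ± d for
-- each offset d. When q is odd, r is even and so i + r/2 = i − r/2.
-- For r ≥ q + 1 with q r even, no offset is 0 modulo r, so i ≢ j excludes
-- nothing; it makes this a simple graph for all q and r. The graph is
-- q-regular only under these conditions on q and r.
circulant : (q r : ℕ) → Graph
circulant q r = record
  { order    = r
  ; Adj      = λ i j → i ≢ j × Any (λ d → Shift d i j) (offsets q r)
  ; adj?     = λ i j → ¬? (i Fin.≟ j) ×-dec Any.any? (λ d → shift? d i j) (offsets q r)
  ; adj-sym  = λ (i≢j , p) → ≢-sym i≢j , Any.map Sum.swap p
  ; loopless = λ (i≢i , _) → i≢i refl
  }
  where
  Shift : ℕ → Rel (Fin r) 0ℓ
  Shift d i j = toℕ j ≡ toℕ i + d [mod r ] ⊎ toℕ i ≡ toℕ j + d [mod r ]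

  shift? : ∀ d → Decidable (Shift d)
  shift? d i j = (r ∣? _) ⊎-dec (r ∣? _)

P : (δ h t n s : ℕ) → List ℕ
P δ h t n s =
  concat (applyUpTo (λ i → replicate s (δ + i * h)) t) ++ replicate (n ∸ t * s) (δ + t * h)

G₀ : (δ h t n s : ℕ) → Graph
G₀ δ h t n s = ⨄ (applyUpTo (λ i → circulant (δ + i * h) s) t ++ last (n ∸ t * s))
  where
  last : ℕ → List Graph
  last zero      = []
  last b@(suc _) = [ circulant (δ + t * h) b ]

{-# OPTIONS --safe #-}

-- All degrees of G₀ have the form δ + i h with h = k + 1, so a vertex set of
-- spread at most k lies in one degree class; the classes have s elements, and
-- possibly one has b = n − t s ≤ s. The value of f is the hypothesis on 2m
-- solved for s.
--
-- For the connected graph, each circulant of degree at least 2 is a cycle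
-- 0, 1, …, r − 1 with further edges, hence stays connected without the edge
-- {0, r − 1}. Take two graphs with such a removable edge, and replace these two
-- edges by two edges across: the degrees are unchanged, the result is
-- connected, and either new edge is removable. Iterating over the components
-- connects them all.

module Submission where

open import Defs
open import Data.Bool.Base using (true; false; if_then_else_)
open import Data.Fin.Base using (Fin; zero; suc; toℕ; fromℕ; fromℕ<; inject₁; splitAt; _↑ˡ_; _↑ʳ_)
import Data.Fin.Induction as Fin
import Data.Fin.Properties as Fin
open import Data.Fin.Subset using (Subset; ∣_∣; _∈_; _⊆_)
open import Data.Fin.Subset.Properties
  using (_∈?_; p⊆q⇒∣p∣≤∣q∣; nonempty?; Empty-unique; ∣⊥∣≡0)
open import Data.Integer.Base as ℤ using (ℤ; +_)
import Data.Integer.Properties as ℤ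
import Data.Integer.Tactic.RingSolver as ℤ-Solver
open import Data.List.Base as List
  using (List; []; _∷_; [_]; _++_; map; length; filter; concat; replicate; applyUpTo; upTo; allFin)
open import Data.List.Extrema.Nat using (xs≤max; ⊥≤max; max≤v⁺; v≤min⁺; min≤xs; min≤⊤)
import Data.List.Membership.Propositional as List
open import Data.List.Membership.Propositional using (find; lose)
open import Data.List.Membership.Propositional.Properties
  using (∈-map⁺; ∈-map⁻; ∈-++⁺ˡ; ∈-++⁺ʳ; ∈-++⁻; ∈-filter⁺; ∈-filter⁻; ∈-allFin; ∈-upTo⁺; ∈-upTo⁻)
open import Data.List.Membership.Propositional.Properties.WithK using (unique∧set⇒bag)
open import Data.List.Properties
  using ( map-tabulate; map-cong; map-cong-local; map-++; map-∘; map-applyUpTo; tabulate-cong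
        ; filter-all; filter-none; filter-++; filter-≐; concat-++; ++-assoc; ++-identityʳ
        ; length-++; length-map; length-upTo; length-tabulate; length-replicate )
open import Data.List.Relation.Binary.BagAndSetEquality using (∼bag⇒↭)
open import Data.List.Relation.Binary.Permutation.Propositional using (↭-reflexive)
open import Data.List.Relation.Binary.Permutation.Propositional.Properties using (↭-length)
open import Data.List.Relation.Unary.All as All using (All; []; _∷_)
import Data.List.Relation.Unary.All.Properties as All
open import Data.List.Relation.Unary.AllPairs using ([]; _∷_)
open import Data.List.Relation.Unary.Any using (Any; here; there)
open import Data.List.Relation.Unary.Unique.Propositional using (Unique)
import Data.List.Relation.Unary.Unique.Propositional.Properties as Unique
open import Data.Nat.Base as ℕ hiding (_/_)
open import Data.Nat.DivMod
  using (%-remove-+ʳ; %-distribˡ-+; m≡m%n+[m/n]*n; [m+n]%n≡m%n; m%n<n; m<n⇒m%n≡m)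
open import Data.Nat.Divisibility
  using (_∣_; _∣?_; divides; ∣-reflexive; >⇒∤; ∣m+n∣m⇒∣n; ∣1⇒≡1; _∣0)
open import Data.Nat.Primality using (euclidsLemma; prime[2])
open import Data.Nat.Properties
import Data.Nat.Tactic.RingSolver as ℕ-Solver
open import Data.Product.Base as Product using (_×_; _,_; proj₁; proj₂; ∃)
open import Data.Rational.Base as ℚ using (_/_; toℚᵘ)
import Data.Rational.Properties as ℚ
open import Data.Rational.Unnormalised.Base as ℚᵘ using (mkℚᵘ; _≃_; *≡*)
import Data.Rational.Unnormalised.Properties as ℚᵘ
open import Data.Sum.Base as Sum using (_⊎_; inj₁; inj₂)
open import Data.Sum.Relation.Binary.Pointwise using (inj₁; inj₂)
open import Data.Vec.Base as Vec using ([]; _∷_; lookup)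
open import Data.Vec.Properties using (lookup∘tabulate; []=⇒lookup; lookup⇒[]=)
open import Function.Base using (_∘_; id)
open import Function.Bundles using (mk⇔)
open import Function.Definitions using (Injective)
open import Level using (0ℓ)
open import Relation.Binary.Construct.Closure.ReflexiveTransitive as Star using (Star; ε; _◅_; _◅◅_)
open import Relation.Binary.Core using (Rel; _⇒_)
import Relation.Binary.Definitions as Binary
open import Relation.Binary.PropositionalEquality hiding ([_])
open import Relation.Nullary using (Dec; yes; no; does; ¬_; contradiction)
open import Relation.Nullary.Decidable
  using (dec-true; dec-false; decidable-stable; ¬?; _×-dec_; _⊎-dec_)
open import Relation.Unary using (Pred; Decidable)

-- Degree classes and spread

degrees : Graph → List ℕ
degrees G = map (degree G) (allFin (order G))

multiplicity : ℕ → List ℕ → ℕ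
multiplicity d xs = length (filter (_≟ d) xs)

-- Two duplicate-free lists with the same members are permutations of each other. A degree is thus
-- computed by exhibiting a duplicate-free list of all neighbours.
length-filter-allFin : ∀ {n} {P : Pred (Fin n) 0ℓ} (P? : Decidable P) {xs} → Unique xs →
  (∀ {i} → i List.∈ xs → P i) → (∀ {i} → P i → i List.∈ xs) →
  length (filter P? (allFin n)) ≡ length xs
length-filter-allFin {n} P? uniq sound complete =
  ↭-length (∼bag⇒↭ (unique∧set⇒bag (Unique.filter⁺ P? (Unique.allFin⁺ n)) uniq
    (mk⇔ (complete ∘ proj₂ ∘ ∈-filter⁻ P? {xs = allFin n}) (∈-filter⁺ P? (∈-allFin _) ∘ sound))))

length-filter-tabulate : ∀ {a} {A : Set a} {P : Pred A 0ℓ} (P? : Decidable P) {n}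
  (f : Fin n → A) (B : Subset n) → (∀ i → does (P? (f i)) ≡ lookup B i) →
  length (filter P? (List.tabulate f)) ≡ ∣ B ∣
length-filter-tabulate P? f []      eq = refl
length-filter-tabulate P? f (b ∷ B) eq with does (P? (f zero)) | eq zero
... | true  | refl = cong suc (length-filter-tabulate P? (f ∘ suc) B (eq ∘ suc))
... | false | refl = length-filter-tabulate P? (f ∘ suc) B (eq ∘ suc)

module _ (G : Graph) where

  degreeClass : ℕ → Subset (order G)
  degreeClass d = Vec.tabulate (λ v → does (degree G v ≟ d))

  ∈-degreeClass⁺ : ∀ {d v} → degree G v ≡ d → v ∈ degreeClass d
  ∈-degreeClass⁺ {d} {v} eq =
    lookup⇒[]= v _ (trans (lookup∘tabulate _ v) (dec-true (degree G v ≟ d) eq))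

  ∈-degreeClass⁻ : ∀ {d v} → v ∈ degreeClass d → degree G v ≡ d
  ∈-degreeClass⁻ {d} {v} v∈ = decidable-stable (degree G v ≟ d) λ neq →
    contradiction (trans (sym (dec-false (degree G v ≟ d) neq))
                         (trans (sym (lookup∘tabulate _ v)) ([]=⇒lookup v∈))) λ ()

  ∣degreeClass∣ : ∀ d → ∣ degreeClass d ∣ ≡ multiplicity d (degrees G)
  ∣degreeClass∣ d = sym (trans
    (cong (length ∘ filter (_≟ d)) (map-tabulate id (degree G)))
    (length-filter-tabulate (_≟ d) (degree G) (degreeClass d) (λ v → sym (lookup∘tabulate _ v))))

  ∈-degreesOn⁺ : ∀ {B v} → v ∈ B → degree G v List.∈ degreesOn G B
  ∈-degreesOn⁺ {B} v∈B = ∈-map⁺ (degree G) (∈-filter⁺ (_∈? B) (∈-allFin _) v∈B)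

  ∈-degreesOn⁻ : ∀ {B d} → d List.∈ degreesOn G B → ∃ λ v → v ∈ B × d ≡ degree G v
  ∈-degreesOn⁻ {B} d∈ =
    let v , v∈ , eq = ∈-map⁻ (degree G) d∈
    in v , proj₂ (∈-filter⁻ (_∈? B) {xs = allFin (order G)} v∈) , eq

∸≤range : ∀ {x y} xs → x List.∈ xs → y List.∈ xs → x ∸ y ≤ range xs
∸≤range (d ∷ ds) x∈ y∈ =
  ∸-mono (All.lookup (⊥≤max d ds ∷ xs≤max d ds) x∈) (All.lookup (min≤⊤ d ds ∷ min≤xs d ds) y∈)

range-constant : ∀ {d} xs → All (_≡ d) xs → range xs ≡ 0
range-constant []       _             = refl
range-constant (d ∷ ds) (refl ∷ ds≡d) = m≤n⇒m∸n≡0 (≤-trans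
  (max≤v⁺ ≤-refl (All.map ≤-reflexive ds≡d))
  (v≤min⁺ ≤-refl (All.map (≤-reflexive ∘ sym) ds≡d)))

-- In a set of spread at most `k`, any two degrees differ by at most `k` in either order, so the
-- separation hypothesis makes them equal and the set lies in one degree class. Conversely a degree
-- class has spread 0, and the class of `d` attains the bound.
Sp-largest-class : ∀ (G : Graph) {k c} →
  (∀ {x y} → x List.∈ degrees G → y List.∈ degrees G → x ∸ y ≤ k → y ∸ x ≤ k → x ≡ y) →
  (∀ d → multiplicity d (degrees G) ≤ c) →
  ∀ d → multiplicity d (degrees G) ≡ c →
  Sp[ G , k ]≡ c
Sp-largest-class G {k} {c} separated bound d attained =
  (degreeClass G d , spread≤k , trans (∣degreeClass∣ G d) attained) , upper
  where
  open ≤-Reasoning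
  spread≤k : spread G (degreeClass G d) ≤ k
  spread≤k = ≤-trans (≤-reflexive (range-constant (degreesOn G (degreeClass G d))
    (All.tabulate λ e∈ → let v , v∈ , eq = ∈-degreesOn⁻ G {degreeClass G d} e∈ in
                         trans eq (∈-degreeClass⁻ G v∈)))) z≤n

  degree∈ : ∀ v → degree G v List.∈ degrees G
  degree∈ v = ∈-map⁺ (degree G) (∈-allFin v)

  upper : ∀ B → spread G B ≤ k → ∣ B ∣ ≤ c
  upper B sp≤k with nonempty? B
  -- An empty set has no vertex whose degree could name a class, so its cardinality is bounded
  -- directly.
  ... | no empty rewrite Empty-unique empty | ∣⊥∣≡0 (order G) = z≤n
  ... | yes (u , u∈B) = begin
    ∣ B ∣                                     ≤⟨ p⊆q⇒∣p∣≤∣q∣ B⊆class ⟩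
    ∣ degreeClass G (degree G u) ∣            ≡⟨ ∣degreeClass∣ G _ ⟩
    multiplicity (degree G u) (degrees G)     ≤⟨ bound _ ⟩
    c                                         ∎
    where
    close : ∀ {v w} → v ∈ B → w ∈ B → degree G v ∸ degree G w ≤ k
    close v∈ w∈ = ≤-trans (∸≤range (degreesOn G B) (∈-degreesOn⁺ G v∈) (∈-degreesOn⁺ G w∈)) sp≤k

    B⊆class : B ⊆ degreeClass G (degree G u)
    B⊆class {v} v∈B = ∈-degreeClass⁺ G
      (separated (degree∈ v) (degree∈ u) (close v∈B u∈B) (close u∈B v∈B))

-- Disjoint unions

-- A view of the vertices of a disjoint union: matching on it replaces a vertex by an explicit
-- injection, on which `splitAt` computes by rewriting.
data Split {m n} : Fin (m + n) → Set where
  left  : ∀ i → Split (i ↑ˡ n)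
  right : ∀ j → Split (m ↑ʳ j)

split : ∀ m {n} (i : Fin (m + n)) → Split {m} {n} i
split m i with splitAt m i in eq
... | inj₁ j = subst Split (Fin.splitAt⁻¹-↑ˡ eq) (left j)
... | inj₂ j = subst Split (Fin.splitAt⁻¹-↑ʳ eq) (right j)

tabulate-+ : ∀ {a} {A : Set a} m {n} (f : Fin (m + n) → A) →
  List.tabulate f ≡ List.tabulate (f ∘ (_↑ˡ n)) ++ List.tabulate (f ∘ (m ↑ʳ_))
tabulate-+ zero    f = refl
tabulate-+ (suc m) f = cong (f zero ∷_) (tabulate-+ m (f ∘ suc))

module _ (G H : Graph) where
  private
    m = order G
    n = order H

  Adj-⊎ˡ⁺ : ∀ {u v} → Adj G u v → Adj (G ⊎ᴳ H) (u ↑ˡ n) (v ↑ˡ n)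
  Adj-⊎ˡ⁺ {u} {v} p rewrite Fin.splitAt-↑ˡ m u n | Fin.splitAt-↑ˡ m v n = inj₁ p

  Adj-⊎ʳ⁺ : ∀ {u v} → Adj H u v → Adj (G ⊎ᴳ H) (m ↑ʳ u) (m ↑ʳ v)
  Adj-⊎ʳ⁺ {u} {v} p rewrite Fin.splitAt-↑ʳ m n u | Fin.splitAt-↑ʳ m n v = inj₂ p

  Adj-⊎ˡ⁻ : ∀ {u v} → Adj (G ⊎ᴳ H) (u ↑ˡ n) (v ↑ˡ n) → Adj G u v
  Adj-⊎ˡ⁻ {u} {v} p rewrite Fin.splitAt-↑ˡ m u n | Fin.splitAt-↑ˡ m v n with p
  ... | inj₁ q = q

  Adj-⊎ʳ⁻ : ∀ {u v} → Adj (G ⊎ᴳ H) (m ↑ʳ u) (m ↑ʳ v) → Adj H u v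
  Adj-⊎ʳ⁻ {u} {v} p rewrite Fin.splitAt-↑ʳ m n u | Fin.splitAt-↑ʳ m n v with p
  ... | inj₂ q = q

  ¬Adj-⊎ : ∀ {u v} → ¬ Adj (G ⊎ᴳ H) (u ↑ˡ n) (m ↑ʳ v)
  ¬Adj-⊎ {u} {v} p rewrite Fin.splitAt-↑ˡ m u n | Fin.splitAt-↑ʳ m n v with p
  ... | ()

  -- No edge crosses between the two summands, so the neighbours in the union are exactly the
  -- injected neighbours in `G`.
  degree-⊎ˡ : ∀ u → degree (G ⊎ᴳ H) (u ↑ˡ n) ≡ degree G u
  degree-⊎ˡ u = trans
    (length-filter-allFin (adj? (G ⊎ᴳ H) (u ↑ˡ n))
      (Unique.map⁺ (Fin.↑ˡ-injective n _ _) (Unique.filter⁺ (adj? G u) (Unique.allFin⁺ m)))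
      sound (λ {i} → complete (split m i)))
    (length-map (_↑ˡ n) (filter (adj? G u) (allFin m)))
    where
    neighbours = map (_↑ˡ n) (filter (adj? G u) (allFin m))

    sound : ∀ {i} → i List.∈ neighbours → Adj (G ⊎ᴳ H) (u ↑ˡ n) i
    sound i∈ with v , v∈ , refl ← ∈-map⁻ (_↑ˡ n) i∈ =
      Adj-⊎ˡ⁺ (proj₂ (∈-filter⁻ (adj? G u) {xs = allFin m} v∈))

    complete : ∀ {i} → Split i → Adj (G ⊎ᴳ H) (u ↑ˡ n) i → i List.∈ neighbours
    complete (left v)  p = ∈-map⁺ (_↑ˡ n) (∈-filter⁺ (adj? G u) (∈-allFin v) (Adj-⊎ˡ⁻ p))
    complete (right v) p = contradiction p ¬Adj-⊎

  degree-⊎ʳ : ∀ u → degree (G ⊎ᴳ H) (m ↑ʳ u) ≡ degree H u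
  degree-⊎ʳ u = trans
    (length-filter-allFin (adj? (G ⊎ᴳ H) (m ↑ʳ u))
      (Unique.map⁺ (Fin.↑ʳ-injective m _ _) (Unique.filter⁺ (adj? H u) (Unique.allFin⁺ n)))
      sound (λ {i} → complete (split m i)))
    (length-map (m ↑ʳ_) (filter (adj? H u) (allFin n)))
    where
    neighbours = map (m ↑ʳ_) (filter (adj? H u) (allFin n))

    sound : ∀ {i} → i List.∈ neighbours → Adj (G ⊎ᴳ H) (m ↑ʳ u) i
    sound i∈ with v , v∈ , refl ← ∈-map⁻ (m ↑ʳ_) i∈ =
      Adj-⊎ʳ⁺ (proj₂ (∈-filter⁻ (adj? H u) {xs = allFin n} v∈))

    complete : ∀ {i} → Split i → Adj (G ⊎ᴳ H) (m ↑ʳ u) i → i List.∈ neighbours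
    complete (left v)  p = contradiction (adj-sym (G ⊎ᴳ H) {m ↑ʳ u} {v ↑ˡ n} p) ¬Adj-⊎
    complete (right v) p = ∈-map⁺ (m ↑ʳ_) (∈-filter⁺ (adj? H u) (∈-allFin v) (Adj-⊎ʳ⁻ p))

  degrees-⊎ : degrees (G ⊎ᴳ H) ≡ degrees G ++ degrees H
  degrees-⊎ = begin
    map deg (allFin (m + n))
      ≡⟨ map-tabulate id deg ⟩
    List.tabulate deg
      ≡⟨ tabulate-+ m deg ⟩
    List.tabulate (deg ∘ (_↑ˡ n)) ++ List.tabulate (deg ∘ (m ↑ʳ_))
      ≡⟨ cong₂ _++_ (tabulate-cong degree-⊎ˡ) (tabulate-cong degree-⊎ʳ) ⟩
    List.tabulate (degree G) ++ List.tabulate (degree H)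
      ≡⟨ cong₂ _++_ (map-tabulate id (degree G)) (map-tabulate id (degree H)) ⟨
    degrees G ++ degrees H ∎
    where
    open ≡-Reasoning
    deg = degree (G ⊎ᴳ H)

degrees-⨄ : ∀ Gs → degrees (⨄ Gs) ≡ concat (map degrees Gs)
degrees-⨄ []       = refl
degrees-⨄ (G ∷ Gs) = trans (degrees-⊎ G (⨄ Gs)) (cong (degrees G ++_) (degrees-⨄ Gs))

-- Switching two edges

module _ {n} {P Q : Pred (Fin n) 0ℓ} (P? : Decidable P) (Q? : Decidable Q) where

  -- Without `x` on one side and `y` on the other, both predicates select the same elements. It
  -- serves a vertex that trades one neighbour for another.
  length-filter-exchange : ∀ {x y} → P x → Q y →
    (∀ {z} → P z → z ≢ x → Q z × z ≢ y) → (∀ {z} → Q z → z ≢ y → P z × z ≢ x) →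
    length (filter P? (allFin n)) ≡ length (filter Q? (allFin n))
  length-filter-exchange {x} {y} px qy f g =
    trans (remove P? px)
      (trans (cong (suc ∘ length) (filter-≐ _ _ (fwd , bwd) (allFin n))) (sym (remove Q? qy)))
    where
    fwd : ∀ {z} → P z × z ≢ x → Q z × z ≢ y
    fwd (p , z≢x) = f p z≢x

    bwd : ∀ {z} → Q z × z ≢ y → P z × z ≢ x
    bwd (q , z≢y) = g q z≢y

    remove : ∀ {R : Pred (Fin n) 0ℓ} (R? : Decidable R) {x} → R x →
      length (filter R? (allFin n)) ≡
      suc (length (filter (λ z → R? z ×-dec ¬? (z Fin.≟ x)) (allFin n)))
    remove {R} R? {x} rx = length-filter-allFin R?
      (All.tabulate (λ z∈ x≡z → proj₂ (proj₂ (∈-filter⁻ R≢? {xs = allFin n} z∈)) (sym x≡z))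
        ∷ Unique.filter⁺ R≢? (Unique.allFin⁺ n))
      (λ { (here refl) → rx ; (there z∈) → proj₁ (proj₂ (∈-filter⁻ R≢? {xs = allFin n} z∈)) })
      complete
      where
      R≢? = λ z → R? z ×-dec ¬? (z Fin.≟ x)

      complete : ∀ {z} → R z → z List.∈ x ∷ filter R≢? (allFin n)
      complete {z} rz with z Fin.≟ x
      ... | yes refl = here refl
      ... | no z≢x   = there (∈-filter⁺ R≢? (∈-allFin z) (rz , z≢x))

Joins : ∀ {n} → (x y : Fin n) → Rel (Fin n) 0ℓ
Joins x y u v = (u ≡ x × v ≡ y) ⊎ (u ≡ y × v ≡ x)

joins? : ∀ {n} (x y : Fin n) → Binary.Decidable (Joins x y)
joins? x y u v = ((u Fin.≟ x) ×-dec (v Fin.≟ y)) ⊎-dec ((u Fin.≟ y) ×-dec (v Fin.≟ x))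

Joins-sym : ∀ {n} {x y : Fin n} → Binary.Symmetric (Joins x y)
Joins-sym (inj₁ (p , q)) = inj₂ (q , p)
Joins-sym (inj₂ (p , q)) = inj₁ (q , p)

-- The edges ab and cd are to be replaced by ad and cb. The negative fields ensure that the new
-- edges are neither present already nor loops; otherwise degrees could drop.
record Switchable (K : Graph) (a b c d : Vertex K) : Set where
  field
    ab  : Adj K a b
    cd  : Adj K c d
    ¬ad : ¬ Adj K a d
    ¬cb : ¬ Adj K c b
    a≢d : a ≢ d
    c≢b : c ≢ b

  a≢b : a ≢ b
  a≢b refl = loopless K ab
  a≢c : a ≢ c
  -- If a and c coincided, the edge cd would be the excluded edge ad.
  a≢c refl = ¬ad cd

SwitchAdj : (K : Graph) (a b c d : Vertex K) → Rel (Vertex K) 0ℓ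
SwitchAdj K a b c d u v =
  (Adj K u v × ¬ (Joins a b u v ⊎ Joins c d u v)) ⊎ (Joins a d u v ⊎ Joins c b u v)

switch : ∀ (K : Graph) {a b c d} → Switchable K a b c d → Graph
switch K {a} {b} {c} {d} sw = record
  { order    = order K
  ; Adj      = SwitchAdj K a b c d
  ; adj?     = λ u v → (adj? K u v ×-dec ¬? (joins? a b u v ⊎-dec joins? c d u v))
                       ⊎-dec (joins? a d u v ⊎-dec joins? c b u v)
  ; adj-sym  = Sum.map (Product.map (adj-sym K) (_∘ Sum.map Joins-sym Joins-sym))
                       (Sum.map Joins-sym Joins-sym)
  ; loopless = λ where
      (inj₁ (p , _))                    → loopless K p
      (inj₂ (inj₁ (inj₁ (refl , a≡d)))) → a≢d a≡d
      (inj₂ (inj₁ (inj₂ (refl , d≡a)))) → a≢d (sym d≡a)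
      (inj₂ (inj₂ (inj₁ (refl , c≡b)))) → c≢b c≡b
      (inj₂ (inj₂ (inj₂ (refl , b≡c)))) → c≢b (sym b≡c)
  }
  where open Switchable sw

-- The vertex `a` loses the neighbour `b`, gains `d`, and keeps all others.
degree-switch-end : ∀ (K : Graph) {a b c d} (sw : Switchable K a b c d) →
  degree (switch K sw) a ≡ degree K a
degree-switch-end K {a} {b} {c} {d} sw =
  length-filter-exchange (adj? (switch K sw) a) (adj? K a)
    (inj₂ (inj₁ (inj₁ (refl , refl)))) ab fwd bwd
  where
  open Switchable sw
  fwd : ∀ {z} → SwitchAdj K a b c d a z → z ≢ d → Adj K a z × z ≢ b
  fwd (inj₁ (p , ¬old)) _                = p , λ z≡b → ¬old (inj₁ (inj₁ (refl , z≡b)))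
  fwd (inj₂ (inj₁ (inj₁ (_ , z≡d)))) z≢d = contradiction z≡d z≢d
  fwd (inj₂ (inj₁ (inj₂ (a≡d , _)))) _   = contradiction a≡d a≢d
  fwd (inj₂ (inj₂ (inj₁ (a≡c , _)))) _   = contradiction a≡c a≢c
  fwd (inj₂ (inj₂ (inj₂ (a≡b , _)))) _   = contradiction a≡b a≢b

  bwd : ∀ {z} → Adj K a z → z ≢ b → SwitchAdj K a b c d a z × z ≢ d
  bwd p z≢b = inj₁ (p , ¬old) , λ { refl → ¬ad p }
    where
    ¬old : ¬ (Joins a b a _ ⊎ Joins c d a _)
    ¬old (inj₁ (inj₁ (_ , z≡b))) = z≢b z≡b
    ¬old (inj₁ (inj₂ (a≡b , _))) = a≢b a≡b
    ¬old (inj₂ (inj₁ (a≡c , _))) = a≢c a≡c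
    ¬old (inj₂ (inj₂ (a≡d , _))) = a≢d a≡d

-- Old and new edges form unordered pairs of unordered pairs, so each of the
-- four vertices may play the role of a.
SwitchAdj-rotate : ∀ (K : Graph) a b c d → SwitchAdj K a b c d ⇒ SwitchAdj K c d a b
SwitchAdj-rotate K a b c d = Sum.map (Product.map₂ (_∘ Sum.swap)) Sum.swap

SwitchAdj-reflect : ∀ (K : Graph) a b c d → SwitchAdj K a b c d ⇒ SwitchAdj K b a d c
SwitchAdj-reflect K a b c d =
  Sum.map (Product.map₂ (_∘ Sum.map Sum.swap Sum.swap)) (Sum.swap ∘ Sum.map Sum.swap Sum.swap)

rotate : ∀ {K : Graph} {a b c d} → Switchable K a b c d → Switchable K c d a b
rotate sw = record { ab = cd ; cd = ab ; ¬ad = ¬cb ; ¬cb = ¬ad ; a≢d = c≢b ; c≢b = a≢d }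
  where open Switchable sw

reflect : ∀ {K : Graph} {a b c d} → Switchable K a b c d → Switchable K b a d c
reflect {K} sw = record
  { ab = adj-sym K ab ; cd = adj-sym K cd ; ¬ad = ¬cb ∘ adj-sym K ; ¬cb = ¬ad ∘ adj-sym K
  ; a≢d = ≢-sym c≢b ; c≢b = ≢-sym a≢d }
  where open Switchable sw

degree-rotate : ∀ (K : Graph) {a b c d} (sw : Switchable K a b c d) v →
  degree (switch K sw) v ≡ degree (switch K (rotate sw)) v
degree-rotate K {a} {b} {c} {d} sw v = cong length
  (filter-≐ (adj? (switch K sw) v) (adj? (switch K (rotate sw)) v)
    (SwitchAdj-rotate K a b c d , SwitchAdj-rotate K c d a b) (allFin (order K)))

degree-reflect : ∀ (K : Graph) {a b c d} (sw : Switchable K a b c d) v →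
  degree (switch K sw) v ≡ degree (switch K (reflect sw)) v
degree-reflect K {a} {b} {c} {d} sw v = cong length
  (filter-≐ (adj? (switch K sw) v) (adj? (switch K (reflect sw)) v)
    (SwitchAdj-reflect K a b c d , SwitchAdj-reflect K b a d c) (allFin (order K)))

module _ (K : Graph) {a b c d} (sw : Switchable K a b c d) where

  -- A vertex other than the four ends keeps its neighbourhood; each of the four ends is moved to
  -- the role of `a` by the symmetries of the switch.
  degree-switch : ∀ v → degree (switch K sw) v ≡ degree K v
  degree-switch v = cases (v Fin.≟ a) (v Fin.≟ b) (v Fin.≟ c) (v Fin.≟ d)
    where
    others : v ≢ a → v ≢ b → v ≢ c → v ≢ d → degree (switch K sw) v ≡ degree K v
    others v≢a v≢b v≢c v≢d = cong length
      (filter-≐ (adj? (switch K sw) v) (adj? K v) (fwd , λ p → inj₁ (p , ¬old)) (allFin (order K)))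
      where
      fwd : ∀ {w} → SwitchAdj K a b c d v w → Adj K v w
      fwd (inj₁ (p , _))                 = p
      fwd (inj₂ (inj₁ (inj₁ (v≡a , _)))) = contradiction v≡a v≢a
      fwd (inj₂ (inj₁ (inj₂ (v≡d , _)))) = contradiction v≡d v≢d
      fwd (inj₂ (inj₂ (inj₁ (v≡c , _)))) = contradiction v≡c v≢c
      fwd (inj₂ (inj₂ (inj₂ (v≡b , _)))) = contradiction v≡b v≢b

      ¬old : ∀ {w} → ¬ (Joins a b v w ⊎ Joins c d v w)
      ¬old (inj₁ (inj₁ (v≡a , _))) = v≢a v≡a
      ¬old (inj₁ (inj₂ (v≡b , _))) = v≢b v≡b
      ¬old (inj₂ (inj₁ (v≡c , _))) = v≢c v≡c
      ¬old (inj₂ (inj₂ (v≡d , _))) = v≢d v≡d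

    cases : Dec (v ≡ a) → Dec (v ≡ b) → Dec (v ≡ c) → Dec (v ≡ d) →
      degree (switch K sw) v ≡ degree K v
    cases (yes refl) _ _ _ = degree-switch-end K sw
    cases _ (yes refl) _ _ = trans (degree-reflect K sw v) (degree-switch-end K (reflect sw))
    cases _ _ (yes refl) _ = trans (degree-rotate K sw v) (degree-switch-end K (rotate sw))
    -- Rotation yields the order c, d, a, b, and reflection of that yields d, c, b, a.
    cases _ _ _ (yes refl) =
      trans (degree-rotate K sw v)
        (trans (degree-reflect K (rotate sw) v) (degree-switch-end K (reflect (rotate sw))))
    cases (no v≢a) (no v≢b) (no v≢c) (no v≢d) = others v≢a v≢b v≢c v≢d

-- Splicing connected graphs

-- The graph stays connected without the edge between first and last.
record Rim (G : Graph) : Set where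
  field
    {first last} : Vertex G
    rim          : Adj G first last
    reach        : ∀ v → Star (λ u w → Adj G u w × ¬ Joins first last u w) first v

Rim⇒Connected : ∀ {G} → Rim G → Connected G
Rim⇒Connected {G} R u v = Star.reverse (adj-sym G) (path u) ◅◅ path v
  where
  open Rim R
  path : ∀ w → Star (Adj G) first w
  path w = Star.map proj₁ (reach w)

module _ (G H : Graph) (R : Rim G) (S : Rim H) where
  private
    module R = Rim R
    module S = Rim S
    m = order G
    n = order H
    inˡ : Vertex G → Vertex (G ⊎ᴳ H)
    inˡ = _↑ˡ n
    inʳ : Vertex H → Vertex (G ⊎ᴳ H)
    inʳ = m ↑ʳ_

    apart : ∀ {u v} → inˡ u ≢ inʳ v
    apart {u} {v} eq
      with trans (sym (Fin.splitAt-↑ˡ m u n)) (trans (cong (splitAt m) eq) (Fin.splitAt-↑ʳ m n v))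
    ... | ()

  -- With this order of arguments the new edges join the last vertex of each graph to the first
  -- vertex of the other.
  switchable : Switchable (G ⊎ᴳ H) (inˡ R.last) (inˡ R.first) (inʳ S.last) (inʳ S.first)
  switchable = record
    { ab  = Adj-⊎ˡ⁺ G H (adj-sym G R.rim)
    ; cd  = Adj-⊎ʳ⁺ G H (adj-sym H S.rim)
    ; ¬ad = ¬Adj-⊎ G H
    ; ¬cb = ¬Adj-⊎ G H ∘ adj-sym (G ⊎ᴳ H) {inʳ S.last} {inˡ R.first}
    ; a≢d = apart
    ; c≢b = ≢-sym apart
    }

  splice : Graph
  splice = switch (G ⊎ᴳ H) switchable

  degrees-splice : degrees splice ≡ degrees G ++ degrees H
  degrees-splice = trans
    (map-cong (degree-switch (G ⊎ᴳ H) switchable) (allFin (m + n)))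
    (degrees-⊎ G H)

  -- A walk runs through `G` without its rim to the last vertex, crosses to the first vertex of `H`,
  -- and continues without the rim of `H`. It never uses the other new edge, between the first
  -- vertex of `G` and the last of `H`, which therefore becomes the rim.
  Rim-splice : Rim splice
  Rim-splice = record
    { first = inˡ R.first
    ; last  = inʳ S.last
    ; rim   = inj₂ (inj₂ (inj₂ (refl , refl)))
    ; reach = λ v → reach (split m v)
    }
    where
    Step : Rel (Vertex splice) 0ℓ
    Step u w = Adj splice u w × ¬ Joins (inˡ R.first) (inʳ S.last) u w

    stepˡ : ∀ {u w} → Adj G u w × ¬ Joins R.first R.last u w → Step (inˡ u) (inˡ w)
    stepˡ (p , ¬rim) =
      inj₁ (Adj-⊎ˡ⁺ G H p , λ where
        -- The switch lists the old rim from last to first, while `Rim` lists it from first to last,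
        -- so the two orientations are exchanged.
        (inj₁ (inj₁ (x , y))) → ¬rim (inj₂ (Fin.↑ˡ-injective n _ _ x , Fin.↑ˡ-injective n _ _ y))
        (inj₁ (inj₂ (x , y))) → ¬rim (inj₁ (Fin.↑ˡ-injective n _ _ x , Fin.↑ˡ-injective n _ _ y))
        (inj₂ (inj₁ (x , _))) → apart x
        (inj₂ (inj₂ (x , _))) → apart x)
      , λ where
        (inj₁ (_ , y)) → apart y
        (inj₂ (x , _)) → apart x

    stepʳ : ∀ {u w} → Adj H u w × ¬ Joins S.first S.last u w → Step (inʳ u) (inʳ w)
    stepʳ (p , ¬rim) =
      inj₁ (Adj-⊎ʳ⁺ G H p , λ where
        (inj₂ (inj₁ (x , y))) → ¬rim (inj₂ (Fin.↑ʳ-injective m _ _ x , Fin.↑ʳ-injective m _ _ y))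
        (inj₂ (inj₂ (x , y))) → ¬rim (inj₁ (Fin.↑ʳ-injective m _ _ x , Fin.↑ʳ-injective m _ _ y))
        (inj₁ (inj₁ (x , _))) → apart (sym x)
        (inj₁ (inj₂ (x , _))) → apart (sym x))
      , λ where
        (inj₁ (x , _)) → apart (sym x)
        (inj₂ (_ , y)) → apart (sym y)

    last≢first : R.last ≢ R.first
    last≢first eq = loopless G (subst (Adj G R.first) eq R.rim)

    crossing : Step (inˡ R.last) (inʳ S.first)
    crossing = inj₂ (inj₁ (inj₁ (refl , refl))) , λ where
      (inj₁ (x , _)) → last≢first (Fin.↑ˡ-injective n _ _ x)
      (inj₂ (x , _)) → apart x

    reach : ∀ {v} → Split v → Star Step (inˡ R.first) v
    reach (left v)  = Star.gmap inˡ stepˡ (R.reach v)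
    reach (right v) =
      Star.gmap inˡ stepˡ (R.reach R.last) ◅◅ crossing ◅ Star.gmap inʳ stepʳ (S.reach v)

-- The list is nonempty by its form, since the empty graph has no rim and could not start the
-- recursion.
splice-all : ∀ {G Gs} → Rim G → All Rim Gs →
  ∃ λ H → degrees H ≡ concat (map degrees (G ∷ Gs)) × Rim H
splice-all {G} R []       = G , sym (++-identityʳ _) , R
splice-all {G} R (S ∷ Rs) =
  let H , eq , R′ = splice-all S Rs
  in splice G H R R′
   , trans (degrees-splice G H R R′) (cong (degrees G ++_) eq)
   , Rim-splice G H R R′

-- Circulant graphs

module _ {r : ℕ} .{{_ : NonZero r}} where

  [mod]⇒%≡ : ∀ a b → a ≡ b [mod r ] → a % r ≡ b % r
  [mod]⇒%≡ a b r∣ with ≤-total a b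
  ... | inj₁ a≤b = begin
    a % r               ≡⟨ %-remove-+ʳ a (subst (r ∣_) (m≤n⇒∣m-n∣≡n∸m a≤b) r∣) ⟨
    (a + (b ∸ a)) % r   ≡⟨ cong (_% r) (m+[n∸m]≡n a≤b) ⟩
    b % r               ∎
    where open ≡-Reasoning
  ... | inj₂ b≤a = begin
    a % r               ≡⟨ cong (_% r) (m+[n∸m]≡n b≤a) ⟨
    (b + (a ∸ b)) % r   ≡⟨ %-remove-+ʳ b (subst (r ∣_) (m≤n⇒∣n-m∣≡n∸m b≤a) r∣) ⟩
    b % r               ∎
    where open ≡-Reasoning

  -- Equal remainders cancel in the distance, which is then `r` times the distance of the quotients.
  %≡⇒[mod] : ∀ a b → a % r ≡ b % r → a ≡ b [mod r ]
  %≡⇒[mod] a b eq = divides ∣ a ℕ./ r - b ℕ./ r ∣ (begin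
    ∣ a - b ∣
      ≡⟨ cong₂ ∣_-_∣ (m≡m%n+[m/n]*n a r) (m≡m%n+[m/n]*n b r) ⟩
    ∣ a % r + a ℕ./ r * r - b % r + b ℕ./ r * r ∣
      ≡⟨ cong (λ c → ∣ a % r + a ℕ./ r * r - c + b ℕ./ r * r ∣) eq ⟨
    ∣ a % r + a ℕ./ r * r - a % r + b ℕ./ r * r ∣
      ≡⟨ ∣m+n-m+o∣≡∣n-o∣ (a % r) _ _ ⟩
    ∣ a ℕ./ r * r - b ℕ./ r * r ∣
      ≡⟨ *-distribʳ-∣-∣ r (a ℕ./ r) (b ℕ./ r) ⟨
    ∣ a ℕ./ r - b ℕ./ r ∣ * r ∎)
    where open ≡-Reasoning

  %≡-+ʳ : ∀ {a b} c → a % r ≡ b % r → (a + c) % r ≡ (b + c) % r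
  %≡-+ʳ {a} {b} c eq = trans (%-distribˡ-+ a c r)
    (trans (cong (λ x → (x + c % r) % r) eq) (sym (%-distribˡ-+ b c r)))

  -- Shifting by `r ∸ d` undoes a shift by `d`; this reverses the direction of an offset.
  %≡-complement : ∀ {a b d} → d ≤ r → a % r ≡ (b + d) % r → (a + (r ∸ d)) % r ≡ b % r
  %≡-complement {a} {b} {d} d≤r eq = begin
    (a + (r ∸ d)) % r       ≡⟨ %≡-+ʳ (r ∸ d) eq ⟩
    (b + d + (r ∸ d)) % r   ≡⟨ cong (_% r) (+-assoc b d (r ∸ d)) ⟩
    (b + (d + (r ∸ d))) % r ≡⟨ cong (λ x → (b + x) % r) (m+[n∸m]≡n d≤r) ⟩
    (b + r) % r             ≡⟨ [m+n]%n≡m%n b r ⟩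
    b % r                   ∎
    where open ≡-Reasoning

  -- The distance of `d` and `e` is a multiple of `r` and less than `r`, hence 0.
  %≡-cancelˡ : ∀ i {d e} → d < r → e < r → (i + d) % r ≡ (i + e) % r → d ≡ e
  %≡-cancelˡ i {d} {e} d<r e<r eq = decidable-stable (d ≟ e) λ d≢e →
    >⇒∤ {{≢-nonZero (d≢e ∘ ∣m-n∣≡0⇒m≡n)}}
      (≤-<-trans (∣m-n∣≤m⊔n d e) (⊔-lub d<r e<r))
      (subst (r ∣_) (∣m+n-m+o∣≡∣n-o∣ i d e) (%≡⇒[mod] (i + d) (i + e) eq))

-- Injectivity is asked only under `P`, because shifts modulo `r` and truncated subtraction from `r`
-- are injective only on a bounded range.
Unique-map⁺ : ∀ {a b p} {A : Set a} {B : Set b} {P : Pred A p} {f : A → B} →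
  (∀ {x y} → P x → P y → f x ≡ f y → x ≡ y) →
  ∀ {xs} → All P xs → Unique xs → Unique (map f xs)
Unique-map⁺ inj []         []         = []
Unique-map⁺ inj (px ∷ pxs) (x∉ ∷ uxs) =
  All.map⁺ (All.zipWith (λ (py , x≢y) eq → x≢y (inj px py eq)) (pxs , x∉)) ∷ Unique-map⁺ inj pxs uxs

halving : ∀ n → n ≡ ⌊ n /2⌋ + ⌊ n /2⌋ ⊎ n ≡ suc (⌊ n /2⌋ + ⌊ n /2⌋)
halving zero          = inj₁ refl
halving (suc zero)    = inj₂ refl
halving (suc (suc n)) = Sum.map
  (λ eq → trans (cong (_+_ 2) eq) step)
  (λ eq → trans (cong (_+_ 2) eq) (cong suc step))
  (halving n)
  where
  step = cong suc (sym (+-suc ⌊ n /2⌋ ⌊ n /2⌋))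

2∣n+n : ∀ n → 2 ∣ n + n
2∣n+n n = divides n (trans (cong (_+_ n) (sym (+-identityʳ n))) (*-comm 2 n))

2∤1+n+n : ∀ n → ¬ 2 ∣ suc (n + n)
2∤1+n+n n 2∣ = contradiction
  (∣m+n∣m⇒∣n (subst (2 ∣_) (+-comm 1 (n + n)) 2∣) (2∣n+n n))
  λ 2∣1 → contradiction (∣1⇒≡1 2∣1) λ ()

half-even : ∀ {n} → 2 ∣ n → ⌊ n /2⌋ + ⌊ n /2⌋ ≡ n
half-even {n} 2∣n with halving n
... | inj₁ eq = sym eq
... | inj₂ eq = contradiction (subst (2 ∣_) eq 2∣n) (2∤1+n+n ⌊ n /2⌋)

half-odd : ∀ {n} → ¬ 2 ∣ n → suc (⌊ n /2⌋ + ⌊ n /2⌋) ≡ n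
half-odd {n} 2∤n with halving n
... | inj₁ eq = contradiction (subst (2 ∣_) (sym eq) (2∣n+n ⌊ n /2⌋)) 2∤n
... | inj₂ eq = sym eq

map-const : ∀ {a b} {A : Set a} {B : Set b} (y : B) (xs : List A) →
  map (λ _ → y) xs ≡ replicate (length xs) y
map-const y []       = refl
map-const y (x ∷ xs) = cong (y ∷_) (map-const y xs)

module Circulant (q r : ℕ) (q<r : q < r) (even : 2 ∣ r * q) where

  private
    instance
      r≢0 : NonZero r
      r≢0 = >-nonZero (≤-trans (s≤s z≤n) q<r)

    p = ⌊ q /2⌋

    short middle : List ℕ
    short  = map suc (upTo p)
    middle = if does (2 ∣? q) then [] else [ ⌊ r /2⌋ ]

  -- The last part lists the offsets −1, …, −p modulo r.
  residues : List ℕ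
  residues = offsets q r ++ map (λ x → r ∸ suc x) (upTo p)

  -- For odd `q` the evenness of `r * q` and Euclid's lemma for 2 force `r` to be even, so that the
  -- middle offset is exactly half of `r`. It contributes one neighbour, against two for each short
  -- offset.
  middle-facts : Unique middle × All (λ d → d + d ≡ r) middle × p + p + length middle ≡ q
  middle-facts with 2 ∣? q
  ... | yes 2∣q rewrite dec-true (2 ∣? q) 2∣q = [] , [] , trans (+-identityʳ _) (half-even 2∣q)
  ... | no  2∤q rewrite dec-false (2 ∣? q) 2∤q with euclidsLemma r q prime[2] even
  ...   | inj₁ 2∣r = [] ∷ [] , half-even 2∣r ∷ [] , trans (+-comm (p + p) 1) (half-odd 2∤q)
  ...   | inj₂ 2∣q = contradiction 2∣q 2∤q

  2p<r : p + p < r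
  2p<r = ≤-<-trans (≤-trans (m≤m+n (p + p) _) (≤-reflexive (proj₂ (proj₂ middle-facts)))) q<r

  ∈-short⁻ : ∀ {d} → d List.∈ short → 0 < d × d ≤ p
  ∈-short⁻ d∈ with x , x∈ , refl ← ∈-map⁻ suc d∈ = s≤s z≤n , ∈-upTo⁻ x∈

  ∈-middle⁻ : ∀ {d} → d List.∈ middle → p < d × d + d ≡ r
  ∈-middle⁻ d∈ with d+d≡r ← All.lookup (proj₁ (proj₂ middle-facts)) d∈ =
    ≰⇒> (λ d≤p → <⇒≱ 2p<r (≤-trans (≤-reflexive (sym d+d≡r)) (+-mono-≤ d≤p d≤p))) , d+d≡r

  ∈-offsets-bounds : ∀ {d} → d List.∈ offsets q r → 0 < d × d + d ≤ r
  ∈-offsets-bounds d∈ with ∈-++⁻ short d∈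
  ... | inj₁ d∈short  =
    let 0<d , d≤p = ∈-short⁻ d∈short in 0<d , ≤-trans (+-mono-≤ d≤p d≤p) (<⇒≤ 2p<r)
  ... | inj₂ d∈middle =
    let p<d , eq = ∈-middle⁻ d∈middle in ≤-<-trans z≤n p<d , ≤-reflexive eq

  ∈-offsets-< : ∀ {d} → d List.∈ offsets q r → d < r
  ∈-offsets-< {d} d∈ = let 0<d , d+d≤r = ∈-offsets-bounds d∈ in
    <-≤-trans (m<m+n d 0<d) d+d≤r

  ∈-residues⁺ : ∀ {d} → d List.∈ offsets q r → d List.∈ residues × r ∸ d List.∈ residues
  ∈-residues⁺ {d} d∈ = ∈-++⁺ˡ d∈ , mirrored (∈-++⁻ short d∈)
    where
    mirrored : d List.∈ short ⊎ d List.∈ middle → r ∸ d List.∈ residues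
    mirrored (inj₁ d∈short) with x , x∈ , refl ← ∈-map⁻ suc d∈short =
      ∈-++⁺ʳ (offsets q r) (∈-map⁺ (λ x → r ∸ suc x) x∈)
    -- The middle offset is its own negative modulo `r`, so it is not mirrored a second time.
    mirrored (inj₂ d∈middle) = ∈-++⁺ˡ (subst (List._∈ offsets q r)
      (sym (trans (cong (_∸ d) (sym (proj₂ (∈-middle⁻ d∈middle)))) (m+n∸m≡n d d))) d∈)

  ∈-residues⁻ : ∀ {d} → d List.∈ residues → ∃ λ e → e List.∈ offsets q r × (d ≡ e ⊎ d ≡ r ∸ e)
  ∈-residues⁻ {d} d∈ with ∈-++⁻ (offsets q r) d∈
  ... | inj₁ d∈offsets = d , d∈offsets , inj₁ refl
  ... | inj₂ d∈mirror with x , x∈ , eq ← ∈-map⁻ (λ x → r ∸ suc x) d∈mirror =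
    suc x , ∈-++⁺ˡ (∈-map⁺ suc x∈) , inj₂ eq

  ∈-residues-bounds : ∀ {d} → d List.∈ residues → 0 < d × d < r
  ∈-residues-bounds d∈ with ∈-residues⁻ d∈
  ... | e , e∈ , inj₁ refl = proj₁ (∈-offsets-bounds e∈) , ∈-offsets-< e∈
  ... | e , e∈ , inj₂ refl =
    m<n⇒0<n∸m (∈-offsets-< e∈) , ∸-monoʳ-< (proj₁ (∈-offsets-bounds e∈)) (<⇒≤ (∈-offsets-< e∈))

  suc≤r : ∀ {x} → x List.∈ upTo p → suc x ≤ r
  suc≤r x∈ = ≤-trans (∈-upTo⁻ x∈) (≤-trans (m≤m+n p p) (<⇒≤ 2p<r))

  -- Short offsets are at most `p` and a middle one exceeds `p`. A mirrored d satisfies d + x = r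
  -- for some positive x at most `p`: a short d would give a sum of at most 2p, below r, and a
  -- middle d, with d + d = r, would equal x.
  residues-unique : Unique residues
  residues-unique = Unique.++⁺
    (Unique.++⁺ (Unique.map⁺ suc-injective (Unique.upTo⁺ p)) (proj₁ middle-facts) short∩middle)
    (Unique-map⁺ (λ x<r y<r eq → suc-injective (∸-cancelˡ-≡ x<r y<r eq))
      (All.tabulate suc≤r) (Unique.upTo⁺ p))
    offsets∩mirror
    where
    short∩middle : ∀ {d} → ¬ (d List.∈ short × d List.∈ middle)
    short∩middle (d∈s , d∈m) = <⇒≱ (proj₁ (∈-middle⁻ d∈m)) (proj₂ (∈-short⁻ d∈s))

    offsets∩mirror : ∀ {d} → ¬ (d List.∈ offsets q r × d List.∈ map (λ x → r ∸ suc x) (upTo p))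
    offsets∩mirror {d} (d∈ , d∈mirror)
      with x , x∈ , d≡ ← ∈-map⁻ (λ x → r ∸ suc x) d∈mirror = excluded (∈-++⁻ short d∈)
      where
      d+x≡r : d + suc x ≡ r
      d+x≡r = trans (cong (_+ suc x) d≡) (m∸n+n≡m (suc≤r x∈))

      excluded : ¬ (d List.∈ short ⊎ d List.∈ middle)
      excluded (inj₁ d∈short) =
        <⇒≢ (≤-<-trans (+-mono-≤ (proj₂ (∈-short⁻ d∈short)) (∈-upTo⁻ x∈)) 2p<r) d+x≡r
      excluded (inj₂ d∈middle) with p<d , d+d≡r ← ∈-middle⁻ d∈middle =
        <⇒≱ p<d (subst (_≤ p) (+-cancelˡ-≡ d _ _ (trans d+x≡r (sym d+d≡r))) (∈-upTo⁻ x∈))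

  length-residues : length residues ≡ q
  length-residues = begin
    length residues               ≡⟨ length-++ (offsets q r) ⟩
    length (offsets q r) + length (map (λ x → r ∸ suc x) (upTo p))
      ≡⟨ cong₂ _+_ (length-++ short) (trans (length-map _ (upTo p)) (length-upTo p)) ⟩
    length short + length middle + p
      ≡⟨ cong (λ x → x + length middle + p) (trans (length-map suc (upTo p)) (length-upTo p)) ⟩
    p + length middle + p
      ≡⟨ +-comm (p + length middle) p ⟩
    p + (p + length middle)
      ≡⟨ +-assoc p p _ ⟨
    p + p + length middle
      ≡⟨ proj₂ (proj₂ middle-facts) ⟩
    q ∎
    where open ≡-Reasoning

  -- The neighbours of `i` are its shifts by the `q` residues, which are distinct because the
  -- residues are distinct and below `r`.
  degree-circulant : ∀ i → degree (circulant q r) i ≡ q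
  degree-circulant i = trans
    (length-filter-allFin (adj? (circulant q r) i)
      (Unique-map⁺ shift-injective (All.tabulate (proj₂ ∘ ∈-residues-bounds)) residues-unique)
      sound complete)
    (trans (length-map shift residues) length-residues)
    where
    shift : ℕ → Fin r
    shift d = fromℕ< (m%n<n (toℕ i + d) r)

    toℕ-shift : ∀ d → toℕ (shift d) ≡ (toℕ i + d) % r
    toℕ-shift d = Fin.toℕ-fromℕ< (m%n<n (toℕ i + d) r)

    shift-injective : ∀ {d e} → d < r → e < r → shift d ≡ shift e → d ≡ e
    shift-injective {d} {e} d<r e<r eq = %≡-cancelˡ (toℕ i) d<r e<r
      (trans (sym (toℕ-shift d)) (trans (cong toℕ eq) (toℕ-shift e)))

    toℕ-% : ∀ (j : Fin r) → toℕ j % r ≡ toℕ j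
    toℕ-% j = m<n⇒m%n≡m (Fin.toℕ<n j)

    shift-% : ∀ d → toℕ (shift d) % r ≡ (toℕ i + d) % r
    shift-% d = trans (toℕ-% (shift d)) (toℕ-shift d)

    sound : ∀ {j} → j List.∈ map shift residues → Adj (circulant q r) i j
    sound j∈ with d , d∈ , refl ← ∈-map⁻ shift j∈ = i≢j , edge (∈-residues⁻ d∈)
      where
      i≢j : i ≢ shift d
      -- Since `i` is its own shift by 0, cancellation would give `d` the value 0.
      i≢j i≡j = let 0<d , d<r = ∈-residues-bounds d∈ in
        <⇒≢ 0<d (%≡-cancelˡ (toℕ i) (≤-<-trans z≤n q<r) d<r
          (trans (cong (_% r) (+-identityʳ (toℕ i))) (trans (cong ((_% r) ∘ toℕ) i≡j) (shift-% d))))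

      edge : (∃ λ e → e List.∈ offsets q r × (d ≡ e ⊎ d ≡ r ∸ e)) → Any _ (offsets q r)
      edge (e , e∈ , inj₁ refl) =
        lose e∈ (inj₁ (%≡⇒[mod] (toℕ (shift e)) (toℕ i + e) (shift-% e)))
      -- A shift by `r ∸ e` is a step back by `e`, so the edge is read from its other end: a further
      -- shift by `e` returns to `i`.
      edge (e , e∈ , inj₂ refl) =
        lose e∈ (inj₂ (%≡⇒[mod] (toℕ i) (toℕ (shift (r ∸ e)) + e) (sym (begin
          (toℕ (shift (r ∸ e)) + e) % r
            ≡⟨ %≡-+ʳ {a = toℕ (shift (r ∸ e))} {toℕ i + (r ∸ e)} e (shift-% (r ∸ e)) ⟩
          (toℕ i + (r ∸ e) + e) % r
            ≡⟨ cong (_% r) (+-assoc (toℕ i) (r ∸ e) e) ⟩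
          (toℕ i + (r ∸ e + e)) % r
            ≡⟨ cong (λ x → (toℕ i + x) % r) (m∸n+n≡m (<⇒≤ (∈-offsets-< e∈))) ⟩
          (toℕ i + r) % r
            ≡⟨ [m+n]%n≡m%n (toℕ i) r ⟩
          toℕ i % r ∎))))
        where open ≡-Reasoning

    hit : ∀ {d j} → d List.∈ residues → (toℕ i + d) % r ≡ toℕ j % r → j List.∈ map shift residues
    hit {d} {j} d∈ eq = subst (List._∈ map shift residues)
      (Fin.toℕ-injective (trans (toℕ-shift d) (trans eq (toℕ-% j)))) (∈-map⁺ shift d∈)

    complete : ∀ {j} → Adj (circulant q r) i j → j List.∈ map shift residues
    complete {j} (_ , edge) with find edge
    ... | d , d∈ , inj₁ j≡i+d = hit (proj₁ (∈-residues⁺ d∈))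
      (sym ([mod]⇒%≡ (toℕ j) (toℕ i + d) j≡i+d))
    ... | d , d∈ , inj₂ i≡j+d = hit (proj₂ (∈-residues⁺ d∈))
      (%≡-complement {a = toℕ i} {toℕ j} (<⇒≤ (∈-offsets-< d∈))
        ([mod]⇒%≡ (toℕ i) (toℕ j + d) i≡j+d))

  degrees-circulant : degrees (circulant q r) ≡ replicate r q
  degrees-circulant = trans (map-cong degree-circulant (allFin r))
    (trans (map-const q (allFin r)) (cong (λ n → replicate n q) (length-tabulate id)))

-- As `q` is at least 2, the offset 1 is present and 0, 1, ..., r - 1 is a path; the edge that
-- closes it to a cycle is the rim.
Rim-circulant : ∀ {q r} → 2 ≤ q → q < r → Rim (circulant q r)
Rim-circulant {q} {suc r′} 2≤q q<r = record
  { first = zero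
  ; last  = fromℕ r′
  ; rim   = (λ 0≡r′ → <⇒≢ (≤-trans (s≤s z≤n) 2≤r′) (trans (cong toℕ 0≡r′) (Fin.toℕ-fromℕ r′)))
          , lose 1∈offsets (inj₂ (∣-reflexive (sym last+1≡r)))
  ; reach = Fin.<-weakInduction _ ε (λ i path → path ◅◅ step i ◅ ε)
  }
  where
  2≤r′ : 2 ≤ r′
  2≤r′ = ≤-trans 2≤q (s≤s⁻¹ q<r)

  1∈offsets : 1 List.∈ offsets q (suc r′)
  1∈offsets = ∈-++⁺ˡ (∈-map⁺ suc (∈-upTo⁺ (⌊n/2⌋-mono 2≤q)))

  last+1≡r : toℕ (fromℕ r′) + 1 ≡ suc r′
  last+1≡r = trans (cong (_+ 1) (Fin.toℕ-fromℕ r′)) (+-comm r′ 1)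

  i≢1+i : ∀ (i : Fin r′) → inject₁ i ≢ suc i
  i≢1+i i eq = <⇒≢ (n<1+n (toℕ i)) (trans (sym (Fin.toℕ-inject₁ i)) (cong toℕ eq))

  1+i≡i+1 : ∀ (i : Fin r′) → suc (toℕ i) ≡ toℕ (inject₁ i) + 1 [mod suc r′ ]
  1+i≡i+1 i = subst (suc r′ ∣_)
    (sym (m≡n⇒∣m-n∣≡0 (trans (cong suc (sym (Fin.toℕ-inject₁ i))) (+-comm 1 _)))) (suc r′ ∣0)

  step : ∀ i → Adj (circulant q (suc r′)) (inject₁ i) (suc i)
             × ¬ Joins zero (fromℕ r′) (inject₁ i) (suc i)
  step i = (i≢1+i i , lose 1∈offsets (inj₁ (1+i≡i+1 i))) , λ where
    -- Here i = 0 and i + 1 = r′, so r′ would be 1, whereas r is at least 3.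
    (inj₁ (i≡0 , 1+i≡r′)) → <⇒≢ 2≤r′ (trans
      (cong suc (trans (cong toℕ (sym i≡0)) (Fin.toℕ-inject₁ i)))
      (trans (cong toℕ 1+i≡r′) (Fin.toℕ-fromℕ r′)))
    (inj₂ (_ , ()))

-- The sequence P and the graph G₀

multiplicity-++ : ∀ d xs {ys} → multiplicity d (xs ++ ys) ≡ multiplicity d xs + multiplicity d ys
multiplicity-++ d xs {ys} =
  trans (cong length (filter-++ (_≟ d) xs ys)) (length-++ (filter (_≟ d) xs))

multiplicity-replicate : ∀ d r → multiplicity d (replicate r d) ≡ r
multiplicity-replicate d r =
  trans (cong length (filter-all (_≟ d) (All.replicate⁺ r refl))) (length-replicate r)

multiplicity-absent : ∀ {d xs} → All (_≢ d) xs → multiplicity d xs ≡ 0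
multiplicity-absent {d} ≢d = cong length (filter-none (_≟ d) ≢d)

-- The arithmetic progression of degrees in `P` is abstracted to a function, so that removing the
-- first block leaves the same form with `g ∘ suc` and induction on `t` applies.
blockSequence : (g : ℕ → ℕ) (s t b : ℕ) → List ℕ
blockSequence g s t b = concat (applyUpTo (λ i → replicate s (g i)) t) ++ replicate b (g t)

blockSequence-values : ∀ g s t b {x} → x List.∈ blockSequence g s t b → ∃ λ i → x ≡ g i
blockSequence-values g s t b = All.lookup {P = λ x → ∃ λ i → x ≡ g i} (All.++⁺
  (All.concat⁺ (All.applyUpTo⁺₂ _ t (λ i → All.replicate⁺ s (i , refl))))
  (All.replicate⁺ b (t , refl)))

blockSequence-suc : ∀ g s t b →
  blockSequence g s (suc t) b ≡ replicate s (g 0) ++ blockSequence (g ∘ suc) s t b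
blockSequence-suc g s t b = ++-assoc (replicate s (g 0)) _ _

multiplicity-blockSequence-0 : ∀ {g} → Injective _≡_ _≡_ g → ∀ s t b →
  multiplicity (g 0) (blockSequence g s (suc t) b) ≡ s
multiplicity-blockSequence-0 {g} inj s t b = begin
  multiplicity (g 0) (blockSequence g s (suc t) b)
    ≡⟨ cong (multiplicity (g 0)) (blockSequence-suc g s t b) ⟩
  multiplicity (g 0) (replicate s (g 0) ++ blockSequence (g ∘ suc) s t b)
    ≡⟨ multiplicity-++ (g 0) (replicate s (g 0)) ⟩
  multiplicity (g 0) (replicate s (g 0)) + multiplicity (g 0) (blockSequence (g ∘ suc) s t b)
    ≡⟨ cong₂ _+_ (multiplicity-replicate (g 0) s) (multiplicity-absent later) ⟩
  s + 0
    ≡⟨ +-identityʳ s ⟩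
  s ∎
  where
  open ≡-Reasoning
  later : All (_≢ g 0) (blockSequence (g ∘ suc) s t b)
  later = All.tabulate λ x∈ x≡g0 →
    let i , x≡ = blockSequence-values (g ∘ suc) s t b x∈
    in contradiction (inj (trans (sym x≡) x≡g0)) λ ()

-- By injectivity a value occurs in at most one block, and each block has `s` elements except the
-- final one, which has `b`.
multiplicity-blockSequence-≤ : ∀ {g} → Injective _≡_ _≡_ g → ∀ {s b} → b ≤ s → ∀ t d →
  multiplicity d (blockSequence g s t b) ≤ s
multiplicity-blockSequence-≤ {g} inj {s} {b} b≤s zero d with g 0 ≟ d
... | yes refl = ≤-trans (≤-reflexive (multiplicity-replicate (g 0) b)) b≤s
... | no  g0≢d = ≤-trans (≤-reflexive (multiplicity-absent (All.replicate⁺ b g0≢d))) z≤n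
multiplicity-blockSequence-≤ {g} inj {s} {b} b≤s (suc t) d with g 0 ≟ d
... | yes refl = ≤-reflexive (multiplicity-blockSequence-0 inj s t b)
... | no  g0≢d = begin
  multiplicity d (blockSequence g s (suc t) b)
    ≡⟨ cong (multiplicity d) (blockSequence-suc g s t b) ⟩
  multiplicity d (replicate s (g 0) ++ blockSequence (g ∘ suc) s t b)
    ≡⟨ multiplicity-++ d (replicate s (g 0)) ⟩
  multiplicity d (replicate s (g 0)) + multiplicity d (blockSequence (g ∘ suc) s t b)
    ≡⟨ cong (_+ multiplicity d (blockSequence (g ∘ suc) s t b))
            (multiplicity-absent (All.replicate⁺ s g0≢d)) ⟩
  multiplicity d (blockSequence (g ∘ suc) s t b)
    ≤⟨ multiplicity-blockSequence-≤ (suc-injective ∘ inj) b≤s t d ⟩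
  s ∎
  where open ≤-Reasoning

lastBlock : (d b : ℕ) → List (ℕ × ℕ)
lastBlock d zero      = []
lastBlock d b@(suc _) = [ d , b ]

-- Pairs of degree and size, a common source for `P` and `G₀`: each pair yields a constant block of
-- the sequence and a circulant graph.
blocks : (δ h t n s : ℕ) → List (ℕ × ℕ)
blocks δ h t n s = applyUpTo (λ i → δ + i * h , s) t ++ lastBlock (δ + t * h) (n ∸ t * s)

private
  repeat : ℕ × ℕ → List ℕ
  repeat (q , r) = replicate r q

  circ : ℕ × ℕ → Graph
  circ (q , r) = circulant q r

P≡blocks : ∀ δ h t n s → P δ h t n s ≡ concat (map repeat (blocks δ h t n s))
P≡blocks δ h t n s = sym (trans (cong concat (map-++ repeat (applyUpTo _ t) _))
  (trans (sym (concat-++ (map repeat (applyUpTo _ t)) _))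
    (cong₂ _++_ (cong concat (map-applyUpTo _ repeat t)) last)))
  where
  last : concat (map repeat (lastBlock (δ + t * h) (n ∸ t * s)))
         ≡ replicate (n ∸ t * s) (δ + t * h)
  last with n ∸ t * s
  ... | zero  = refl
  ... | suc b = ++-identityʳ _

-- The final component is defined by cases on its size, so both sides reduce only once that size is
-- matched.
G₀≡blocks : ∀ δ h t n s → G₀ δ h t n s ≡ ⨄ (map circ (blocks δ h t n s))
G₀≡blocks δ h t n s with n ∸ t * s
... | zero  = cong ⨄ (sym (trans (map-++ circ (applyUpTo _ t) [])
                                (cong (_++ []) (map-applyUpTo _ circ t))))
... | suc b = cong ⨄ (sym (trans (map-++ circ (applyUpTo _ t) _)
                                (cong (_++ _) (map-applyUpTo _ circ t))))

-- The value of f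

-- Since `_/_` reduces fractions, the comparison is carried over to unnormalised rationals, where it
-- is a cross-multiplied inequality of integers.
n/1+t≤s⇒n≤s*[1+t] : ∀ n t s → + n / suc t ℚ.≤ + s / 1 → n ≤ s * suc t
n/1+t≤s⇒n≤s*[1+t] n t s le = subst₂ _≤_ (*-identityʳ n) refl (ℤ.drop‿+≤+
  (subst₂ ℤ._≤_ (sym (ℤ.pos-* n 1)) (sym (ℤ.pos-* s (suc t)))
    (ℚᵘ.drop-*≤* (ℚᵘ.≤-respˡ-≃ (ℚ.toℚᵘ-fromℚᵘ (mkℚᵘ (+ n) t))
      (ℚᵘ.≤-respʳ-≃ (ℚ.toℚᵘ-fromℚᵘ (mkℚᵘ (+ s) 0)) (ℚ.toℚᵘ-mono-≤ le))))))

/1-/2≃ : ∀ a x y → + a / 1 ≡ + x / 1 ℚ.- + y / 2 →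
  mkℚᵘ (+ a) 0 ≃ mkℚᵘ (+ x) 0 ℚᵘ.- mkℚᵘ (+ y) 1
/1-/2≃ a x y eq = begin
  mkℚᵘ (+ a) 0
    ≈⟨ ℚ.toℚᵘ-fromℚᵘ (mkℚᵘ (+ a) 0) ⟨
  toℚᵘ (+ a / 1)
    ≡⟨ cong toℚᵘ eq ⟩
  toℚᵘ (+ x / 1 ℚ.- + y / 2)
    ≈⟨ ℚ.toℚᵘ-homo-+ (+ x / 1) (ℚ.- (+ y / 2)) ⟩
  toℚᵘ (+ x / 1) ℚᵘ.+ toℚᵘ (ℚ.- (+ y / 2))
    ≈⟨ ℚᵘ.+-cong (ℚ.toℚᵘ-fromℚᵘ (mkℚᵘ (+ x) 0))
         (ℚᵘ.≃-trans (ℚ.toℚᵘ-homo‿- (+ y / 2)) (ℚᵘ.-‿cong (ℚ.toℚᵘ-fromℚᵘ (mkℚᵘ (+ y) 1)))) ⟩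
  mkℚᵘ (+ x) 0 ℚᵘ.- mkℚᵘ (+ y) 1 ∎
  where open import Relation.Binary.Reasoning.Setoid ℚᵘ.≃-setoid

/1-/2≡ : ∀ a x y → + a / 1 ≡ + x / 1 ℚ.- + y / 2 → + 2 ℤ.* (+ x ℤ.- + a) ≡ + y
/1-/2≡ a x y eq with *≡* e ← /1-/2≃ a x y eq = begin
  + 2 ℤ.* (+ x ℤ.- + a)
    ≡⟨ expand (+ x) (+ a) ⟩
  + x ℤ.* + 2 ℤ.- + a ℤ.* + 2
    ≡⟨ cong (λ z → + x ℤ.* + 2 ℤ.- z) e ⟩
  + x ℤ.* + 2 ℤ.- (+ x ℤ.* + 2 ℤ.+ (ℤ.- + y) ℤ.* + 1) ℤ.* + 1
    ≡⟨ cancel (+ x) (+ y) ⟩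
  + y ∎
  where
  open ≡-Reasoning

  expand : ∀ x a → + 2 ℤ.* (x ℤ.- a) ≡ x ℤ.* + 2 ℤ.- a ℤ.* + 2
  expand = ℤ-Solver.solve-∀

  cancel : ∀ x y → x ℤ.* + 2 ℤ.- (x ℤ.* + 2 ℤ.+ (ℤ.- y) ℤ.* + 1) ℤ.* + 1 ≡ y
  cancel = ℤ-Solver.solve-∀

-- The hypothesis is the conclusion with its denominator cleared.
s≡f : ∀ t n m δ k s .{{_ : NonZero t}} →
  + 2 ℤ.* (+ (n * (δ + t * suc k)) ℤ.- + (2 * m)) ≡ + (s * suc k * t * suc t) →
  + s / 1 ≡ f t n m δ k
s≡f (suc t) n m δ k s eq =
  -- `mkℚᵘ` takes the denominator minus one, whence the `pred`.
  ℚ.fromℚᵘ-cong {mkℚᵘ (+ s) 0} {mkℚᵘ numerator (pred (suc k * (suc t * suc (suc t))))} (*≡* (begin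
    + s ℤ.* + (suc k * (suc t * suc (suc t)))   ≡⟨ ℤ.pos-* s _ ⟨
    + (s * (suc k * (suc t * suc (suc t))))     ≡⟨ cong +_ (assoc s (suc k) (suc t) (suc (suc t))) ⟩
    + (s * suc k * suc t * suc (suc t))         ≡⟨ eq ⟨
    numerator                                   ≡⟨ ℤ.*-identityʳ numerator ⟨
    numerator ℤ.* + 1                           ∎))
  where
  open ≡-Reasoning
  numerator : ℤ
  numerator = + 2 ℤ.* (+ (n * (δ + suc t * suc k)) ℤ.- + (2 * m))

  assoc : ∀ a b c d → a * (b * (c * d)) ≡ a * b * c * d
  assoc = ℕ-Solver.solve-∀

-- Realising `P` by `G₀` and by a connected graph

module _ (δ h t n s : ℕ) (valid : All (λ (q , r) → q < r × 2 ∣ r * q) (blocks δ h t n s)) where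

  degrees-blocks : concat (map degrees (map circ (blocks δ h t n s))) ≡ P δ h t n s
  degrees-blocks = begin
    concat (map degrees (map circ (blocks δ h t n s)))
      ≡⟨ cong concat (map-∘ (blocks δ h t n s)) ⟨
    concat (map (degrees ∘ circ) (blocks δ h t n s))
      ≡⟨ cong concat (map-cong-local (All.map
           (λ { {q , r} (q<r , even) → Circulant.degrees-circulant q r q<r even }) valid)) ⟩
    concat (map repeat (blocks δ h t n s))
      ≡⟨ P≡blocks δ h t n s ⟨
    P δ h t n s ∎
    where open ≡-Reasoning

  degrees-G₀ : degrees (G₀ δ h t n s) ≡ P δ h t n s
  degrees-G₀ = trans (cong degrees (G₀≡blocks δ h t n s))
    (trans (degrees-⨄ (map circ (blocks δ h t n s))) degrees-blocks)

-- Writing the number of full blocks as `suc t` provides a first component from which the splicing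
-- starts.
connected-realisation : ∀ δ h t n s →
  All (λ (q , r) → q < r × 2 ∣ r * q) (blocks δ h (suc t) n s) →
  All (λ (q , _) → 2 ≤ q) (blocks δ h (suc t) n s) →
  ∃ λ H → HasDegreeSequence H (P δ h (suc t) n s) × Connected H
connected-realisation δ h t n s valid 2≤
  with R ∷ Rs ← All.map⁺ {f = circ} (All.zipWith
         (λ { {q , r} ((q<r , _) , 2≤q) → Rim-circulant 2≤q q<r }) (valid , 2≤)) =
  let H , eq , rim = splice-all R Rs
  in H , ↭-reflexive (trans eq (degrees-blocks δ h (suc t) n s valid)) , Rim⇒Connected rim

lastBlock⁺ : ∀ {p} {Q : Pred (ℕ × ℕ) p} {d b} → (b ≢ 0 → Q (d , b)) → All Q (lastBlock d b)
lastBlock⁺ {b = zero}  _ = []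
lastBlock⁺ {b = suc _} q = q (λ ()) ∷ []

proposition11 :
    ∀ (δ k t n m s : ℕ) → .{{_ : NonZero t}} →
    let h = suc k
        b = n ∸ t * s
    in
    1 ≤ δ →
    2 ≤ n →
    n * δ ≤ 2 * m →
    + n / suc t ℚ.≤ + s / 1 →
    + s / 1 ℚ.≤ + n / t →
    + (2 * m) / 1 ≡ + (n * (δ + t * h)) / 1 ℚ.- + (s * h * t * suc t) / 2 →
    δ + (t ∸ 1) * h + 1 ≤ s →
    (∀ i → i < t → 2 ∣ s * (δ + i * h)) →
    (b ≡ 0 ⊎ (δ + t * h + 1 ≤ b × 2 ∣ b * (δ + t * h))) →
    HasDegreeSequence (G₀ δ h t n s) (P δ h t n s)
    × (Sp[ G₀ δ h t n s , k ]≡ s)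
    × (+ s / 1 ≡ f t n m δ k)
    × (2 ≤ δ → ∃ λ (H : Graph) → HasDegreeSequence H (P δ h t n s) × Connected H)
proposition11 δ k (suc t) n m s _ _ _ n/[2+t]≤s _ 2m≡ s-large s-even b-valid =
    ↭-reflexive degs
  , Sp-largest-class (G₀ δ h (suc t) n s)
      (subst Separated (sym degs) separated)
      (λ d → subst (λ ds → multiplicity d ds ≤ s) (sym degs)
        (multiplicity-blockSequence-≤ g-injective b≤s (suc t) d))
      -- The lowest degree `δ` attains the maximum: there is at least one full block, and all other
      -- blocks have larger degrees.
      (g 0)
      (trans (cong (multiplicity (g 0)) degs) (multiplicity-blockSequence-0 g-injective s t b))
  , s≡f (suc t) n m δ k s (/1-/2≡ (2 * m) (n * g (suc t)) (s * h * suc t * suc (suc t)) 2m≡)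
  , λ 2≤δ → connected-realisation δ h t n s valid (All.++⁺
      (All.applyUpTo⁺₂ (λ i → g i , s) (suc t) (λ i → ≤-trans 2≤δ (m≤m+n δ (i * h))))
      (lastBlock⁺ (λ _ → ≤-trans 2≤δ (m≤m+n δ (suc t * h)))))
  where
  h = suc k
  b = n ∸ suc t * s

  g : ℕ → ℕ
  g i = δ + i * h

  g-injective : Injective _≡_ _≡_ g
  g-injective {i} {j} eq = *-cancelʳ-≡ i j h (+-cancelˡ-≡ δ (i * h) (j * h) eq)

  Separated : List ℕ → Set
  Separated ds = ∀ {x y} → x List.∈ ds → y List.∈ ds → x ∸ y ≤ k → y ∸ x ≤ k → x ≡ y

  -- If `j` were smaller than `i`, the two degrees would differ by at least `h`, that is, by more
  -- than `k`.
  index-≤ : ∀ i j → g i ∸ g j ≤ k → i ≤ j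
  index-≤ i j le = ≮⇒≥ λ j<i → <⇒≱ (s≤s le) (begin
    h                    ≡⟨ m+n∸n≡m h (j * h) ⟨
    suc j * h ∸ j * h    ≤⟨ ∸-monoˡ-≤ (j * h) (*-monoˡ-≤ h j<i) ⟩
    i * h ∸ j * h        ≡⟨ [m+n]∸[m+o]≡n∸o δ (i * h) (j * h) ⟨
    g i ∸ g j            ∎)
    where open ≤-Reasoning

  separated : Separated (P δ h (suc t) n s)
  separated x∈ y∈ x∸y≤k y∸x≤k
    with i , refl ← blockSequence-values g s (suc t) b x∈
       | j , refl ← blockSequence-values g s (suc t) b y∈ =
    cong g (≤-antisym (index-≤ i j x∸y≤k) (index-≤ j i y∸x≤k))

  b≤s : b ≤ s
  -- The lower bound on `s`, with denominators cleared, says that one more block of size `s` would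
  -- cover all `n` vertices.
  b≤s = m≤n+o⇒m∸n≤o n (suc t * s) (≤-trans (n/1+t≤s⇒n≤s*[1+t] n (suc t) s n/[2+t]≤s)
    (≤-reflexive (trans (*-comm s (suc (suc t))) (+-comm s (suc t * s)))))

  valid : All (λ (q , r) → q < r × 2 ∣ r * q) (blocks δ h (suc t) n s)
  valid = All.++⁺
    (All.applyUpTo⁺₁ (λ i → g i , s) (suc t) λ {i} i<1+t →
      -- The bound on `s` is given for the largest degree among the full blocks and passes to the
      -- smaller ones by monotonicity.
      (≤-trans (≤-reflexive (+-comm 1 (g i)))
        (≤-trans (+-monoˡ-≤ 1 (+-monoʳ-≤ δ (*-monoˡ-≤ h (s≤s⁻¹ i<1+t)))) s-large))
      , s-even i i<1+t)
    (lastBlock⁺ (last b-valid))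
    where
    last : b ≡ 0 ⊎ (g (suc t) + 1 ≤ b × 2 ∣ b * g (suc t)) →
      b ≢ 0 → g (suc t) < b × 2 ∣ b * g (suc t)
    last (inj₁ b≡0)          b≢0 = contradiction b≡0 b≢0
    last (inj₂ (large , ev)) _   = ≤-trans (≤-reflexive (+-comm 1 (g (suc t)))) large , ev

  degs : degrees (G₀ δ h (suc t) n s) ≡ P δ h (suc t) n s
  degs = degrees-G₀ δ h (suc t) n s valid
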